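{- For every integer $n\ge0$, $$c\phi_{12}(2n+1)\equiv0\pmod{16},\qquad c\phi_{12}(3n+1)\equiv0\pmod9,\qquad c\phi_{12}(3n+2)\equiv0\pmod9.$$
   Context: A $k$-colored generalized Frobenius symbol is a two-row array with $d\ge 0$ columns whose entries are colored nonnegative integers $\ell_c$ ($\ell\ge 0$, color $c\in\{1,\dots,k\}$), each row strictly decreasing with respect to the total order $0_1\prec 0_2\prec\cdots\prec 0_k\prec 1_1\prec\cdots\prec 1_k\prec 2_1\prec\cdots$. It is a $k$-colored generalized Frobenius partition of $n=d+\sum(\text{integer values of all entries})$, and $c\phi_k(n)$ is the number of such partitions of $n$. -}

module Defs where

open import Data.Nat using (ℕ; zero; suc; _+_; _<_; _≟_; _<?_)
open import Data.Fin using (Fin; toℕ)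
open import Data.Product using (_×_; _,_; proj₁; proj₂)
open import Data.Sum using (_⊎_)
open import Data.List using (List; []; _∷_; length; map; concatMap; cartesianProduct; upTo; allFin; filter)
open import Data.Nat.ListAction using (sum)
open import Data.List.Relation.Unary.Linked using (Linked; linked?)
open import Relation.Binary.PropositionalEquality using (_≡_)
open import Relation.Nullary.Decidable using (Dec; _×-dec_; _⊎-dec_)

-- A k-colored nonnegative integer ℓ_c : value ℓ, color c (Fin k, color c+1 in the paper).
Entry : ℕ → Set
Entry k = ℕ × Fin k

value : ∀ {k} → Entry k → ℕ
value = proj₁

_≺_ : ∀ {k} → Entry k → Entry k → Set
(a , c) ≺ (b , d) = (a < b) ⊎ ((a ≡ b) × (toℕ c < toℕ d))

_≺?_ : ∀ {k} (x y : Entry k) → Dec (x ≺ y)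
(a , c) ≺? (b , d) = (a <? b) ⊎-dec ((a ≟ b) ×-dec (toℕ c <? toℕ d))

StrictlyDecreasing : ∀ {k} → List (Entry k) → Set
StrictlyDecreasing = Linked (λ x y → y ≺ x)

strictlyDecreasing? : ∀ {k} (r : List (Entry k)) → Dec (StrictlyDecreasing r)
strictlyDecreasing? = linked? (λ x y → y ≺? x)

-- A two-row array (top row, bottom row).
Symbol : ℕ → Set
Symbol k = List (Entry k) × List (Entry k)

weight : ∀ {k} → Symbol k → ℕ
weight (t , b) = length t + (sum (map value t) + sum (map value b))

IsCFP : (k n : ℕ) → Symbol k → Set
IsCFP k n (t , b) =
  (length t ≡ length b) × (StrictlyDecreasing t × (StrictlyDecreasing b × (weight (t , b) ≡ n)))

isCFP? : (k n : ℕ) (s : Symbol k) → Dec (IsCFP k n s)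
isCFP? k n (t , b) =
  (length t ≟ length b) ×-dec (strictlyDecreasing? t ×-dec (strictlyDecreasing? b ×-dec (weight (t , b) ≟ n)))

listsOfLength : ∀ {A : Set} → ℕ → List A → List (List A)
listsOfLength zero    xs = [] ∷ []
listsOfLength (suc d) xs = concatMap (λ x → map (x ∷_) (listsOfLength d xs)) xs

entriesUpTo : (k n : ℕ) → List (Entry k)
entriesUpTo k n = cartesianProduct (upTo (suc n)) (allFin k)

-- A duplicate-free finite list of candidate symbols containing every
-- k-colored generalized Frobenius partition of n (such a symbol has d ≤ n
-- columns and all values ≤ n).
candidates : (k n : ℕ) → List (Symbol k)
candidates k n =
  concatMap (λ d → cartesianProduct (listsOfLength d (entriesUpTo k n))
                                    (listsOfLength d (entriesUpTo k n)))
            (upTo (suc n))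

cφ : ℕ → ℕ → ℕ
cφ k n = length (filter (isCFP? k n) (candidates k n))

{-# OPTIONS --safe #-}
-- For every value v a symbol selects a set of a colors in the top row and of b
-- colors in the bottom row, so cφ₁₂ n is a sum of products of binomials C(12, a).
-- Let (p, m) be (2, 4) or (3, 3): then m ∣ C(12, a) whenever p ∤ a.  If p ∤ n, some
-- selected set has size prime to p, and because the two rows have equally many
-- entries there are at least two such sets; hence m² divides every product.
module Submission where

open import Defs
open import Data.Nat using (ℕ; suc; _+_; _*_)
open import Data.Nat.Divisibility using (_∣_)
open import Data.Product using (_×_)

open import Data.Nat using (zero; _≤_; _<_; _>_; _≟_; _<?_; s≤s; s<s)
open import Data.Nat.Properties hiding (_≟_; _<?_)
open import Data.Nat.Divisibility
  using (_∣?_; divides; _∣0; m∣m*n; ∣m⇒∣m*n; ∣n⇒∣m*n; *-monoʳ-∣; ∣m∣n⇒∣m+n; ∣m+n∣m⇒∣n)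
open import Data.Nat.Combinatorics using (_C_; nCk+nC[k+1]≡[n+1]C[k+1]; k>n⇒nCk≡0)
open import Data.Nat.ListAction using (sum)
open import Data.Nat.ListAction.Properties using (sum-++)
open import Data.Nat.Tactic.RingSolver using (solve-∀)
open import Data.Fin as Fin using (Fin; toℕ; opposite; fromℕ<)
open import Data.Fin.Properties using (all?; opposite-prop; opposite-involutive; toℕ<n; toℕ-fromℕ<)
open import Data.Bool using (if_then_else_; true; false)
open import Data.Empty using (⊥-elim)
open import Data.Product using (_,_; proj₁; proj₂)
open import Data.Sum using (inj₁; inj₂)
open import Data.List
  using (List; []; _∷_; _++_; length; map; concatMap; filter; tabulate; upTo; downFrom; allFin;
         cartesianProduct; cartesianProductWith)
open import Data.List.Properties using (map-++; map-∘; map-cong; ∷-injective; length-tabulate)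
open import Data.List.Membership.Propositional using (_∈_; _∉_)
open import Data.List.Membership.Propositional.Properties
open import Data.List.Membership.Propositional.Properties.WithK using (unique∧set⇒bag)
open import Data.List.Relation.Binary.BagAndSetEquality using (∼bag⇒↭)
open import Data.List.Relation.Binary.Disjoint.Propositional using (Disjoint)
open import Data.List.Relation.Binary.Permutation.Propositional.Properties using (↭-length)
open import Data.List.Relation.Unary.All as All using (All; []; _∷_)
import Data.List.Relation.Unary.All.Properties as All
open import Data.List.Relation.Unary.AllPairs as AllPairs using (AllPairs; []; _∷_)
import Data.List.Relation.Unary.AllPairs.Properties as AllPairs
open import Data.List.Relation.Unary.Any using (here; there)
open import Data.List.Relation.Unary.Linked.Properties using (Linked⇒AllPairs; AllPairs⇒Linked)
open import Data.List.Relation.Unary.Unique.Propositional using (Unique)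
import Data.List.Relation.Unary.Unique.Propositional.Properties as Unique
open import Function using (_∘_; id; mk⇔)
open import Level using (Level)
open import Relation.Binary using (Rel; Transitive; Irreflexive)
open import Relation.Binary.PropositionalEquality
open import Relation.Nullary using (¬_; Dec; yes; no; does; ¬?; contradiction; _×-dec_; _→-dec_)
open import Relation.Nullary.Decidable using (from-yes)
open import Relation.Unary using (Pred; Decidable)

private
  variable
    ℓ : Level
    A B : Set

-- Sublists

sublists : List A → List (List A)
sublists []       = [] ∷ []
sublists (x ∷ xs) = map (x ∷_) (sublists xs) ++ sublists xs

sublists-All : {P : Pred A ℓ} {xs : List A} → All P xs → ∀ {t} → t ∈ sublists xs → All P t
sublists-All []         (here refl) = []
sublists-All {xs = x ∷ xs} (px ∷ pxs) t∈ with ∈-++⁻ (map (x ∷_) (sublists xs)) t∈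
... | inj₂ t∈ˡ = sublists-All pxs t∈ˡ
... | inj₁ t∈ˡ with _ , u∈ , refl ← ∈-map⁻ (x ∷_) t∈ˡ = px ∷ sublists-All pxs u∈

sublists-AllPairs : {R : Rel A ℓ} {xs : List A} → AllPairs R xs → ∀ {t} → t ∈ sublists xs → AllPairs R t
sublists-AllPairs []         (here refl) = []
sublists-AllPairs {xs = x ∷ xs} (Rx ∷ Rxs) t∈ with ∈-++⁻ (map (x ∷_) (sublists xs)) t∈
... | inj₂ t∈ˡ = sublists-AllPairs Rxs t∈ˡ
... | inj₁ t∈ˡ with _ , u∈ , refl ← ∈-map⁻ (x ∷_) t∈ˡ = sublists-All Rx u∈ ∷ sublists-AllPairs Rxs u∈

[]∈sublists : (xs : List A) → [] ∈ sublists xs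
[]∈sublists []       = here refl
[]∈sublists (x ∷ xs) = ∈-++⁺ʳ (map (x ∷_) (sublists xs)) ([]∈sublists xs)

∈-tail : {x : A} {xs t : List A} → x ∉ t → All (_∈ x ∷ xs) t → All (_∈ xs) t
∈-tail x∉t []                = []
∈-tail x∉t (here refl ∷ t∈)  = ⊥-elim (x∉t (here refl))
∈-tail x∉t (there y∈  ∷ t∈)  = y∈ ∷ ∈-tail (x∉t ∘ there) t∈

module _ {R : Rel A ℓ} (R-trans : Transitive R) (R-irrefl : Irreflexive _≡_ R) where

  ∈-sublists : {xs : List A} → AllPairs R xs → ∀ {t} → AllPairs R t → All (_∈ xs) t → t ∈ sublists xs
  ∈-sublists {xs}     _          {[]}    _          _                = []∈sublists xs
  ∈-sublists {x ∷ xs} (Rx ∷ Rxs) {_ ∷ t} (Ry ∷ Rt)  (here refl ∷ t∈) =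
    ∈-++⁺ˡ (∈-map⁺ (x ∷_) (∈-sublists Rxs Rt (∈-tail (R-irrefl refl ∘ All.lookup Ry) t∈)))
  ∈-sublists {x ∷ xs} (Rx ∷ Rxs) {y ∷ t} (Ry ∷ Rt)  (there y∈ ∷ t∈)  =
    ∈-++⁺ʳ (map (x ∷_) (sublists xs))
      (∈-sublists Rxs (Ry ∷ Rt)
        (y∈ ∷ ∈-tail (λ x∈t → R-irrefl refl (R-trans (All.lookup Rx y∈) (All.lookup Ry x∈t))) t∈))

sublists⁺ : {xs : List A} → Unique xs → Unique (sublists xs)
sublists⁺ [] = [] ∷ []
sublists⁺ {xs = x ∷ xs} (x∉xs ∷ xs!) =
  Unique.++⁺ (Unique.map⁺ (proj₂ ∘ ∷-injective) (sublists⁺ xs!)) (sublists⁺ xs!) disjoint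
  where
  disjoint : Disjoint (map (x ∷_) (sublists xs)) (sublists xs)
  disjoint (t∈₁ , t∈₂) with _ , _ , refl ← ∈-map⁻ (x ∷_) t∈₁ =
    All.lookup x∉xs (All.head (sublists-All (All.tabulate id) t∈₂)) refl

-- Symbols as pairs of sublists

module _ {k : ℕ} where

  ≺-trans : Transitive (_≺_ {k})
  ≺-trans (inj₁ a<b)          (inj₁ b<c)          = inj₁ (<-trans a<b b<c)
  ≺-trans (inj₁ a<b)          (inj₂ (refl , _))   = inj₁ a<b
  ≺-trans (inj₂ (refl , _))   (inj₁ b<c)          = inj₁ b<c
  ≺-trans (inj₂ (refl , c<d)) (inj₂ (refl , d<e)) = inj₂ (refl , <-trans c<d d<e)

  ≺-irrefl : Irreflexive _≡_ (_≺_ {k})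
  ≺-irrefl refl (inj₁ a<a)       = <-irrefl refl a<a
  ≺-irrefl refl (inj₂ (_ , c<c)) = <-irrefl refl c<c

  _≻_ : Rel (Entry k) _
  x ≻ y = y ≺ x

  ≻-trans : Transitive _≻_
  ≻-trans x≻y y≻z = ≺-trans y≻z x≻y

  ≻-irrefl : Irreflexive _≡_ _≻_
  ≻-irrefl x≡y = ≺-irrefl (sym x≡y)

  cartesianProduct-≻ : {vs : List ℕ} {cs : List (Fin k)} → AllPairs _>_ vs → AllPairs Fin._>_ cs →
                       AllPairs _≻_ (cartesianProduct vs cs)
  cartesianProduct-≻ []           cs> = []
  cartesianProduct-≻ {v ∷ vs} {cs} (v> ∷ vs>) cs> =
    AllPairs.++⁺ (AllPairs.map⁺ (AllPairs.map (λ c>d → inj₂ (refl , c>d)) cs>))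
                 (cartesianProduct-≻ vs> cs>)
                 (All.map⁺ (All.tabulate λ _ → All.tabulate λ y∈ →
                   inj₁ (All.lookup v> (proj₁ (∈-cartesianProduct⁻ vs cs y∈)))))

-- Entries in decreasing order

colorsDown : (k : ℕ) → List (Fin k)
colorsDown k = tabulate opposite

∈-colorsDown : ∀ {k} (c : Fin k) → c ∈ colorsDown k
∈-colorsDown c = subst (_∈ colorsDown _) (opposite-involutive c) (∈-tabulate⁺ (opposite c))

colorsDown-> : ∀ k → AllPairs Fin._>_ (colorsDown k)
colorsDown-> k = AllPairs.tabulate⁺-< λ {i} {j} i<j →
  subst₂ _<_ (sym (opposite-prop j)) (sym (opposite-prop i)) (∸-monoʳ-< (s<s i<j) (toℕ<n j))

-- The bound on values is exclusive, whereas that of `entriesUpTo` is inclusive; hence `suc n`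
-- below. Passing from `n` to `suc n` definitionally prepends the block of value `n`, which drives
-- the later induction.
entriesDown : (k n : ℕ) → List (Entry k)
entriesDown k n = cartesianProduct (downFrom n) (colorsDown k)

entriesDown-≻ : ∀ k n → AllPairs _≻_ (entriesDown k n)
entriesDown-≻ k n = cartesianProduct-≻ (AllPairs.applyDownFrom⁺₁ id n λ j<i _ → j<i) (colorsDown-> k)

entriesUpTo⇒entriesDown : ∀ k n {x} → x ∈ entriesUpTo k n → x ∈ entriesDown k (suc n)
entriesUpTo⇒entriesDown k n x∈ =
  ∈-cartesianProduct⁺ (∈-downFrom⁺ (∈-upTo⁻ (proj₁ (∈-cartesianProduct⁻ (upTo (suc n)) (allFin k) x∈))))
                      (∈-colorsDown _)

entriesDown⇒entriesUpTo : ∀ k n {x} → x ∈ entriesDown k (suc n) → x ∈ entriesUpTo k n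
entriesDown⇒entriesUpTo k n x∈ =
  ∈-cartesianProduct⁺ (∈-upTo⁺ (∈-downFrom⁻ (proj₁ (∈-cartesianProduct⁻ (downFrom (suc n)) (colorsDown k) x∈))))
                      (∈-allFin _)

-- Uniqueness and membership for candidate symbols

listsOfLength-suc : ∀ d (xs : List A) →
                    listsOfLength (suc d) xs ≡ cartesianProductWith _∷_ xs (listsOfLength d xs)
listsOfLength-suc d xs = go xs
  where
  -- The list of heads varies while the tails remain lists over the fixed `xs`.
  go : ∀ ys → concatMap (λ y → map (y ∷_) (listsOfLength d xs)) ys
            ≡ cartesianProductWith _∷_ ys (listsOfLength d xs)
  go []       = refl
  go (y ∷ ys) = cong (map (y ∷_) (listsOfLength d xs) ++_) (go ys)

listsOfLength⁺ : ∀ d {xs : List A} → Unique xs → Unique (listsOfLength d xs)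
listsOfLength⁺ zero    xs! = [] ∷ []
listsOfLength⁺ (suc d) {xs} xs! = subst Unique (sym (listsOfLength-suc d xs))
  (Unique.cartesianProductWith⁺ _∷_ ∷-injective xs! (listsOfLength⁺ d xs!))

∈-listsOfLength⁺ : {xs t : List A} → All (_∈ xs) t → t ∈ listsOfLength (length t) xs
∈-listsOfLength⁺ [] = here refl
∈-listsOfLength⁺ {xs = xs} {_ ∷ t} (x∈ ∷ t∈) = subst (_ ∈_) (sym (listsOfLength-suc (length t) xs))
  (∈-cartesianProductWith⁺ _∷_ x∈ (∈-listsOfLength⁺ t∈))

∈-listsOfLength⁻ : ∀ d {xs t : List A} → t ∈ listsOfLength d xs → length t ≡ d × All (_∈ xs) t
∈-listsOfLength⁻ zero    (here refl) = refl , []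
∈-listsOfLength⁻ (suc d) {xs} t∈
  with _ , _ , x∈ , u∈ , refl ← ∈-cartesianProductWith⁻ _∷_ xs (listsOfLength d xs)
                                   (subst (_ ∈_) (listsOfLength-suc d xs) t∈)
  with len , all∈ ← ∈-listsOfLength⁻ d u∈ = cong suc len , x∈ ∷ all∈

module _ (k n : ℕ) where

  private
    rows : ℕ → List (List (Entry k))
    rows d = listsOfLength d (entriesUpTo k n)

    symbolsOfLength : ℕ → List (Symbol k)
    symbolsOfLength d = cartesianProduct (rows d) (rows d)

    decreasingRows : List (List (Entry k))
    decreasingRows = sublists (entriesDown k (suc n))

  -- The blocks for distinct `d` are disjoint because the length of the top row recovers `d`.
  candidates⁺ : Unique (candidates k n)
  candidates⁺ = Unique.concat⁺ {xss = map symbolsOfLength (upTo (suc n))}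
    (All.map⁺ (All.universal (λ d → Unique.cartesianProduct⁺ (rows⁺ d) (rows⁺ d)) (upTo (suc n))))
    (AllPairs.map⁺ {f = symbolsOfLength} (AllPairs.map disjoint (Unique.upTo⁺ (suc n))))
    where
    rows⁺ : ∀ d → Unique (rows d)
    rows⁺ d = listsOfLength⁺ d (Unique.cartesianProduct⁺ (Unique.upTo⁺ (suc n)) (Unique.allFin⁺ k))
    len : ∀ {d s} → s ∈ symbolsOfLength d → length (proj₁ s) ≡ d
    len {d} s∈ = proj₁ (∈-listsOfLength⁻ d (proj₁ (∈-cartesianProduct⁻ (rows d) (rows d) s∈)))
    disjoint : ∀ {d e} → d ≢ e → Disjoint (symbolsOfLength d) (symbolsOfLength e)
    disjoint d≢e (s∈d , s∈e) = d≢e (trans (sym (len s∈d)) (len s∈e))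

  ∈-candidates⁺ : ∀ {t b} → length t ≡ length b → length t ≤ n →
                  All (_∈ entriesUpTo k n) t → All (_∈ entriesUpTo k n) b → (t , b) ∈ candidates k n
  ∈-candidates⁺ {t} {b} t≡b t≤n t∈ b∈ = ∈-concat⁺′
    (∈-cartesianProduct⁺ (∈-listsOfLength⁺ t∈)
                         (subst (λ d → b ∈ rows d) (sym t≡b) (∈-listsOfLength⁺ b∈)))
    (∈-map⁺ symbolsOfLength (∈-upTo⁺ (s≤s t≤n)))

  ∈-candidates⁻ : ∀ {t b} → (t , b) ∈ candidates k n →
                  All (_∈ entriesUpTo k n) t × All (_∈ entriesUpTo k n) b
  ∈-candidates⁻ s∈
    with _ , s∈d , d∈ ← ∈-concat⁻′ (map symbolsOfLength (upTo (suc n))) s∈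
    with d , _ , refl ← ∈-map⁻ symbolsOfLength {xs = upTo (suc n)} d∈
    with t∈ , b∈ ← ∈-cartesianProduct⁻ (rows d) (rows d) s∈d
    = proj₂ (∈-listsOfLength⁻ d t∈) , proj₂ (∈-listsOfLength⁻ d b∈)

  IsBalanced : Symbol k → Set
  IsBalanced (t , b) = length t ≡ length b × weight (t , b) ≡ n

  isBalanced? : Decidable IsBalanced
  isBalanced? (t , b) = (length t ≟ length b) ×-dec (weight (t , b) ≟ n)

  -- Both filtered lists are duplicate-free and have the same elements, so one is a permutation of
  -- the other. Sublists of a decreasing list decrease automatically, which leaves only
  -- `isBalanced?` to test.
  cφ≡sublists : cφ k n ≡ length (filter isBalanced? (cartesianProduct decreasingRows decreasingRows))
  cφ≡sublists = ↭-length (∼bag⇒↭ (unique∧set⇒bag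
    (Unique.filter⁺ (isCFP? k n) candidates⁺)
    (Unique.filter⁺ isBalanced? (Unique.cartesianProduct⁺ decreasingRows⁺ decreasingRows⁺))
    (mk⇔ to from)))
    where
    decreasingRows⁺ : Unique decreasingRows
    decreasingRows⁺ = sublists⁺ (AllPairs.map (λ x≻y x≡y → ≻-irrefl x≡y x≻y) (entriesDown-≻ k (suc n)))

    row∈ : ∀ {t} → StrictlyDecreasing t → All (_∈ entriesUpTo k n) t → t ∈ decreasingRows
    row∈ t↓ t∈ = ∈-sublists ≻-trans ≻-irrefl (entriesDown-≻ k (suc n)) (Linked⇒AllPairs ≻-trans t↓)
                   (All.map (entriesUpTo⇒entriesDown k n) t∈)

    row-entries : ∀ {t} → t ∈ decreasingRows → All (_∈ entriesUpTo k n) t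
    row-entries = sublists-All (All.tabulate (entriesDown⇒entriesUpTo k n))

    row-decreasing : ∀ {t} → t ∈ decreasingRows → StrictlyDecreasing t
    row-decreasing t∈ = AllPairs⇒Linked (sublists-AllPairs (entriesDown-≻ k (suc n)) t∈)

    to : ∀ {s} → s ∈ filter (isCFP? k n) (candidates k n) →
         s ∈ filter isBalanced? (cartesianProduct decreasingRows decreasingRows)
    to s∈ with s∈c , len , t↓ , b↓ , w ← ∈-filter⁻ (isCFP? k n) s∈
          with t∈ , b∈ ← ∈-candidates⁻ s∈c =
      ∈-filter⁺ isBalanced? (∈-cartesianProduct⁺ (row∈ t↓ t∈) (row∈ b↓ b∈)) (len , w)

    from : ∀ {s} → s ∈ filter isBalanced? (cartesianProduct decreasingRows decreasingRows) →
           s ∈ filter (isCFP? k n) (candidates k n)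
    from s∈ with s∈c , len , w ← ∈-filter⁻ isBalanced? s∈
            with t∈ , b∈ ← ∈-cartesianProduct⁻ decreasingRows decreasingRows s∈c =
      ∈-filter⁺ (isCFP? k n)
        -- The number of columns is a summand of the weight, hence at most `n`.
        (∈-candidates⁺ len (≤-trans (m≤m+n _ _) (≤-reflexive w)) (row-entries t∈) (row-entries b∈))
        (len , row-decreasing t∈ , row-decreasing b∈ , w)

-- Sums over sublists

∑ : List A → (A → ℕ) → ℕ
∑ xs f = sum (map f xs)

∑-++ : (f : A → ℕ) (xs ys : List A) → ∑ (xs ++ ys) f ≡ ∑ xs f + ∑ ys f
∑-++ f xs ys = trans (cong sum (map-++ f xs ys)) (sum-++ (map f xs) (map f ys))

∑-map : (f : B → ℕ) (g : A → B) (xs : List A) → ∑ (map g xs) f ≡ ∑ xs (f ∘ g)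
∑-map f g xs = cong sum (sym (map-∘ xs))

∑-cong : {f g : A → ℕ} → (∀ x → f x ≡ g x) → (xs : List A) → ∑ xs f ≡ ∑ xs g
∑-cong f≗g xs = cong sum (map-cong f≗g xs)

∑-*ˡ : (c : ℕ) (f : A → ℕ) (xs : List A) → ∑ xs (λ x → c * f x) ≡ c * ∑ xs f
∑-*ˡ c f []       = sym (*-zeroʳ c)
∑-*ˡ c f (x ∷ xs) = trans (cong (c * f x +_) (∑-*ˡ c f xs)) (sym (*-distribˡ-+ c (f x) (∑ xs f)))

∑-∣ : ∀ {M} (f : A → ℕ) (xs : List A) → (∀ x → M ∣ f x) → M ∣ ∑ xs f
∑-∣ f []       M∣f = _ ∣0
∑-∣ f (x ∷ xs) M∣f = ∣m∣n⇒∣m+n (M∣f x) (∑-∣ f xs M∣f)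

∑-cartesianProduct : (f : A × B → ℕ) (xs : List A) (ys : List B) →
                     ∑ (cartesianProduct xs ys) f ≡ ∑ xs λ x → ∑ ys λ y → f (x , y)
∑-cartesianProduct f []       ys = refl
∑-cartesianProduct f (x ∷ xs) ys = trans (∑-++ f (map (x ,_) ys) _)
  (cong₂ _+_ (∑-map f (x ,_) ys) (∑-cartesianProduct f xs ys))

indicator : {P : Set ℓ} → Dec P → ℕ
indicator P? = if does P? then 1 else 0

indicator-∣ : ∀ {M} {P : Set ℓ} (P? : Dec P) → ¬ P → M ∣ indicator P?
indicator-∣ (yes p) ¬p = contradiction p ¬p
indicator-∣ (no  _) _  = _ ∣0

length-filter≡∑ : {P : Pred A ℓ} (P? : Decidable P) (xs : List A) →
                  length (filter P? xs) ≡ ∑ xs (indicator ∘ P?)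
length-filter≡∑ P? [] = refl
length-filter≡∑ P? (x ∷ xs) with does (P? x)
... | true  = cong suc (length-filter≡∑ P? xs)
... | false = length-filter≡∑ P? xs

-- The summand sees a row only through its length and value sum, so the colors of one value are
-- interchangeable and can be summed out together.
rowSum : ∀ {k} → List (Entry k) → (ℕ → ℕ → ℕ) → ℕ
rowSum xs f = ∑ (sublists xs) λ t → f (length t) (sum (map value t))

shift : ℕ → ℕ → (ℕ → ℕ → ℕ) → ℕ → ℕ → ℕ
shift a s f d r = f (a + d) (s + r)

balanced : ℕ → (d s d′ s′ : ℕ) → ℕ
balanced n d s d′ s′ = indicator ((d ≟ d′) ×-dec (d + (s + s′) ≟ n))

-- The inner sum over bottom rows is again a function of the length and sum of the top row, so facts
-- about `rowSum` apply on both levels.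
cφ≡rowSum : ∀ k n → let xs = entriesDown k (suc n) in
            cφ k n ≡ rowSum xs λ d s → rowSum xs (balanced n d s)
cφ≡rowSum k n = trans (cφ≡sublists k n)
  (trans (length-filter≡∑ (isBalanced? k n) (cartesianProduct S S))
         (∑-cartesianProduct (indicator ∘ isBalanced? k n) S S))
  where S = sublists (entriesDown k (suc n))

rowSum-*ˡ : ∀ {k} (xs : List (Entry k)) c f → rowSum xs (λ d s → c * f d s) ≡ c * rowSum xs f
rowSum-*ˡ xs c f = ∑-*ˡ c _ (sublists xs)

rowSum-∷ : ∀ {k} (x : Entry k) xs f → rowSum (x ∷ xs) f ≡ rowSum xs (shift 1 (value x) f) + rowSum xs f
rowSum-∷ x xs f = trans (∑-++ g (map (x ∷_) (sublists xs)) (sublists xs))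
  (cong (_+ rowSum xs f) (∑-map g (x ∷_) (sublists xs)))
  where g = λ t → f (length t) (sum (map value t))

-- The binomial theorem for a block of entries of equal value

binomialSum : ℕ → (ℕ → ℕ) → ℕ → ℕ
binomialSum k h N = ∑ (downFrom N) λ a → (k C a) * h a

-- Pascal's rule, summed. The term `a = 0` survives only in the second sum, which is therefore one
-- term longer.
binomialSum-suc : ∀ k h N →
  binomialSum (suc k) h (suc N) ≡ binomialSum k (h ∘ suc) N + binomialSum k h (suc N)
binomialSum-suc k h zero    = refl
binomialSum-suc k h (suc N) = begin
  (suc k C suc N) * h (suc N) + binomialSum (suc k) h (suc N)
    ≡⟨ cong₂ (λ c S → c * h (suc N) + S) (sym (nCk+nC[k+1]≡[n+1]C[k+1] k N)) (binomialSum-suc k h N) ⟩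
  (k C N + k C suc N) * h (suc N) + (binomialSum k (h ∘ suc) N + binomialSum k h (suc N))
    ≡⟨ rearrange (k C N) (k C suc N) (h (suc N)) _ _ ⟩
  ((k C N) * h (suc N) + binomialSum k (h ∘ suc) N) + ((k C suc N) * h (suc N) + binomialSum k h (suc N)) ∎
  where
  open ≡-Reasoning
  rearrange : ∀ a b c x y → (a + b) * c + (x + y) ≡ (a * c + x) + (b * c + y)
  rearrange = solve-∀

-- Any `a` of the colors add `a` to the length and `a * v` to the sum, and `length cs C a` counts
-- the choices. Taking or omitting the first color matches Pascal's rule.
rowSum-block : ∀ {k} v (cs : List (Fin k)) xs f →
  rowSum (map (v ,_) cs ++ xs) f
    ≡ binomialSum (length cs) (λ a → rowSum xs (shift a (a * v) f)) (suc (length cs))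
rowSum-block v []       xs f = sym (trans (+-identityʳ _) (*-identityˡ _))
rowSum-block v (c ∷ cs) xs f = begin
  rowSum ((v , c) ∷ map (v ,_) cs ++ xs) f
    ≡⟨ rowSum-∷ (v , c) (map (v ,_) cs ++ xs) f ⟩
  rowSum (map (v ,_) cs ++ xs) (shift 1 v f) + rowSum (map (v ,_) cs ++ xs) f
    ≡⟨ cong₂ _+_ (rowSum-block v cs xs (shift 1 v f)) (rowSum-block v cs xs f) ⟩
  binomialSum k (λ a → rowSum xs (shift a (a * v) (shift 1 v f))) (suc k) + binomialSum k h (suc k)
    ≡⟨ cong₂ _+_ (∑-cong (λ a → cong ((k C a) *_) (∑-cong (shift-shift a) (sublists xs))) (downFrom (suc k)))
                 -- The second sum gains the vanishing term `k C suc k` to fit the range in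
                 -- `binomialSum-suc`.
                 (sym (cong (λ c → c * h (suc k) + binomialSum k h (suc k)) (k>n⇒nCk≡0 (n<1+n k)))) ⟩
  binomialSum k (h ∘ suc) (suc k) + binomialSum k h (suc (suc k))
    ≡⟨ binomialSum-suc k h (suc k) ⟨
  binomialSum (suc k) h (suc (suc k)) ∎
  where
  open ≡-Reasoning
  k = length cs
  h = λ a → rowSum xs (shift a (a * v) f)
  shift-shift : ∀ a (t : List (Entry _)) → let r = sum (map value t) in
                f (suc (a + length t)) (v + (a * v + r)) ≡ f (suc a + length t) (suc a * v + r)
  shift-shift a t = cong (f _) (sym (+-assoc v (a * v) _))

-- Divisibility

module _ (p m : ℕ) where

  -- A test function on (length, sum) that makes up for the powers of m that the
  -- binomials of a row of that length and sum are not bound to contribute.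
  record Compensating (M : ℕ) (f : ℕ → ℕ → ℕ) : Set where
    field
      by-m² : ∀ d s → M ∣ m * (m * f d s)
      by-m  : ∀ d s → ¬ p ∣ d → M ∣ m * f d s
      by-1  : ∀ d s → p ∣ d → p ∣ s → M ∣ f d s

  open Compensating

  -- Adding multiples of `p` to the length and the sum changes neither one's divisibility by `p`.
  shift-∣ : ∀ {M f a s} → p ∣ a → p ∣ s → Compensating M f → Compensating M (shift a s f)
  shift-∣ p∣a p∣s F .by-m² d r       = F .by-m² _ _
  shift-∣ p∣a p∣s F .by-m  d r p∤d   = F .by-m _ _ λ p∣a+d → p∤d (∣m+n∣m⇒∣n p∣a+d p∣a)
  shift-∣ p∣a p∣s F .by-1  d r p∣d p∣r = F .by-1 _ _ (∣m∣n⇒∣m+n p∣a p∣d) (∣m∣n⇒∣m+n p∣s p∣r)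

  -- The factor `m` of the block's binomial moves into the test function, so each field follows from
  -- the next stronger factor of the old one. For `by-1`, a remaining length divisible by `p` makes
  -- the total length `a + d` not divisible.
  shift-∤ : ∀ {M f a s} → ¬ p ∣ a → Compensating M f → Compensating M (λ d r → m * shift a s f d r)
  shift-∤ p∤a F .by-m² d r     = ∣n⇒∣m*n m (F .by-m² _ _)
  shift-∤ p∤a F .by-m  d r _   = F .by-m² _ _
  shift-∤ {a = a} p∤a F .by-1  d r p∣d _ =
    F .by-m _ _ λ p∣a+d → p∤a (∣m+n∣m⇒∣n (subst (p ∣_) (+-comm a d) p∣a+d) p∣d)

  module _ {k : ℕ} (m∣kCa : ∀ a → ¬ p ∣ a → m ∣ k C a) where

    -- Count the blocks of size not divisible by `p`. With none, `p` divides length and sum, and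
    -- `by-1` serves; with exactly one, `p` does not divide the length, and `by-m` serves; two or
    -- more supply `m * m`, and `by-m²` serves.
    rowSum-∣ : ∀ n {M f} → Compensating M f → M ∣ rowSum (entriesDown k n) f
    -- Only the empty row is left; the second summand is the zero that ends the sum over
    -- `sublists []`.
    rowSum-∣ zero    {M} {f} F = ∣m∣n⇒∣m+n (F .by-1 0 0 (p ∣0) (p ∣0)) (M ∣0)
    rowSum-∣ (suc n) {M} {f} F =
      subst (M ∣_) (sym (rowSum-block n (colorsDown k) xs f))
        (∑-∣ _ (downFrom (suc (length (colorsDown k)))) λ a →
          subst (λ c → M ∣ (c C a) * rowSum xs (shift a (a * n) f)) (sym (length-tabulate opposite)) (term a))
      where
      xs = entriesDown k n
      term : ∀ a → M ∣ (k C a) * rowSum xs (shift a (a * n) f)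
      term a with p ∣? a
      ... | yes p∣a = ∣n⇒∣m*n (k C a) (rowSum-∣ n (shift-∣ p∣a (∣m⇒∣m*n n p∣a) F))
      ... | no  p∤a with divides q kCa≡q*m ← m∣kCa a p∤a =
        subst (M ∣_) (begin
            q * rowSum xs (λ d r → m * g d r) ≡⟨ cong (q *_) (rowSum-*ˡ xs m g) ⟩
            q * (m * rowSum xs g)             ≡⟨ *-assoc q m _ ⟨
            q * m * rowSum xs g               ≡⟨ cong (_* rowSum xs g) kCa≡q*m ⟨
            (k C a) * rowSum xs g               ∎)
          (∣n⇒∣m*n q (rowSum-∣ n (shift-∤ p∤a F)))
        where
        open ≡-Reasoning
        g = shift a (a * n) f

    -- `rowSum-∣` is applied to the top row with the bottom sum as test function, and its fields are
    -- met by applying `rowSum-∣` to the bottom row.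
    m²∣cφ : ∀ {n} → ¬ p ∣ n → m * m ∣ cφ k n
    m²∣cφ {n} p∤n = subst (m * m ∣_) (sym (cφ≡rowSum k n)) (rowSum-∣ (suc n) top)
      where
      m²∣ : ∀ x → m * m ∣ m * (m * x)
      m²∣ x = subst (m * m ∣_) (*-assoc m m x) (m∣m*n x)

      balanced? : ∀ d s d′ s′ → Dec (d ≡ d′ × d + (s + s′) ≡ n)
      balanced? d s d′ s′ = (d ≟ d′) ×-dec (d + (s + s′) ≟ n)

      bottom-∤ : ∀ d s → ¬ p ∣ d → Compensating m (balanced n d s)
      bottom-∤ d s p∤d .by-m² _  _  = m∣m*n _
      bottom-∤ d s p∤d .by-m  _  _ _ = m∣m*n _
      -- Equal lengths are impossible here, so the indicator is zero.
      bottom-∤ d s p∤d .by-1  d′ s′ p∣d′ _ =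
        indicator-∣ (balanced? d s d′ s′) λ { (refl , _) → p∤d p∣d′ }

      bottom-∣ : ∀ d s → p ∣ d → p ∣ s → Compensating (m * m) (balanced n d s)
      bottom-∣ d s p∣d p∣s .by-m² _  _  = m²∣ _
      bottom-∣ d s p∣d p∣s .by-m  d′ s′ p∤d′ =
        ∣n⇒∣m*n m (indicator-∣ (balanced? d s d′ s′) λ { (refl , _) → p∤d′ p∣d })
      -- Here `p ∤ n` enters: the weight `d + (s + s′)` would be a multiple of `p`.
      bottom-∣ d s p∣d p∣s .by-1  d′ s′ p∣d′ p∣s′ =
        indicator-∣ (balanced? d s d′ s′) λ { (_ , refl) → p∤n (∣m∣n⇒∣m+n p∣d (∣m∣n⇒∣m+n p∣s p∣s′)) }

      top : Compensating (m * m) (λ d s → rowSum (entriesDown k (suc n)) (balanced n d s))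
      top .by-m² d s         = m²∣ _
      -- One `m` comes from the top row, so the bottom row, of the same length, owes only the other.
      top .by-m  d s p∤d     = *-monoʳ-∣ m (rowSum-∣ (suc n) (bottom-∤ d s p∤d))
      top .by-1  d s p∣d p∣s = rowSum-∣ (suc n) (bottom-∣ d s p∣d p∣s)

-- Binomial coefficients of twelve

∀≤⇒∀C : ∀ {p m} k → (∀ (a : Fin (suc k)) → ¬ p ∣ toℕ a → m ∣ k C toℕ a) → ∀ a → ¬ p ∣ a → m ∣ k C a
∀≤⇒∀C {p} {m} k h a p∤a with a <? suc k
... | yes a≤k = subst (λ a → m ∣ k C a) (toℕ-fromℕ< a≤k)
                  (h (fromℕ< a≤k) (subst (λ a → ¬ p ∣ a) (sym (toℕ-fromℕ< a≤k)) p∤a))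
-- Beyond `k` the coefficient is zero, so a finite check suffices.
... | no  a≰k = subst (m ∣_) (sym (k>n⇒nCk≡0 (≮⇒≥ a≰k))) (m ∣0)

-- The thirteen cases are decided by evaluation. The underlying reason, for this and the next lemma,
-- is that `a * (12 C a)` equals `12 * (11 C (a - 1))` for positive `a`: when the prime does not
-- divide `a`, its full power in 12 must divide `12 C a`.
4∣12C : ∀ a → ¬ 2 ∣ a → 4 ∣ 12 C a
4∣12C = ∀≤⇒∀C 12 (from-yes (all? {n = 13} λ a → ¬? (2 ∣? toℕ a) →-dec (4 ∣? 12 C toℕ a)))

3∣12C : ∀ a → ¬ 3 ∣ a → 3 ∣ 12 C a
3∣12C = ∀≤⇒∀C 12 (from-yes (all? {n = 13} λ a → ¬? (3 ∣? toℕ a) →-dec (3 ∣? 12 C toℕ a)))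

∤*+ : ∀ p n {r} → ¬ p ∣ r → ¬ p ∣ p * n + r
∤*+ p n p∤r p∣ = p∤r (∣m+n∣m⇒∣n p∣ (m∣m*n n))

theorem6p8 : (n : ℕ) →
    (16 ∣ cφ 12 (2 * n + 1)) × ((9 ∣ cφ 12 (3 * n + 1)) × (9 ∣ cφ 12 (3 * n + 2)))
theorem6p8 n =
  m²∣cφ 2 4 4∣12C (∤*+ 2 n (from-yes (¬? (2 ∣? 1)))) ,
  m²∣cφ 3 3 3∣12C (∤*+ 3 n (from-yes (¬? (3 ∣? 1)))) ,
  m²∣cφ 3 3 3∣12C (∤*+ 3 n (from-yes (¬? (3 ∣? 2))))
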